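{- There exist a constant $c>0$ and, for infinitely many $n$, a simple undirected unweighted graph $G$ on $n$ nodes together with an initial coloring of its nodes with two colors, such that in the sequential benevolent model the minority process on $G$ has stabilization time at least $c\,n^{3/2}$; that is, every sequence of valid single-node steps starting from the initial coloring and ending in a stable coloring has length at least $c\,n^{3/2}$ (i.e., the stabilization time is $\Omega(n^{3/2})$).
   Context: Let $G$ be a simple, unweighted, undirected graph whose nodes are colored with two colors (black and white). A node $v$ is switchable in the current coloring if, with $v$ currently colored $c_1$, the other color $c_2$ occurs strictly fewer times than $c_1$ among the neighbors of $v$; switching $v$ means changing its color to the color least frequent in its neighborhood (with two colors: to the other color). The minority process is a sequence of steps, each step consisting of a set of nodes that switch simultaneously; a step is valid only if every chosen node is switchable in the coloring before the step. A coloring is stable if no node is switchable, and the stabilization time is the number of steps until a stable coloring is reached. In the sequential benevolent model, each step switches exactly one switchable node, and the order is chosen by a benevolent player who minimizes the number of steps until stabilization; thus the stabilization time is the minimum length of a sequence of valid single-node steps leading to a stable coloring. -}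

module Defs where

open import Data.Nat using (ℕ; zero; suc; _<_)
open import Data.Bool using (Bool; true; false; not; _∧_; if_then_else_)
open import Data.Fin using (Fin; _≟_)
open import Data.List using (List; map; allFin)
open import Data.Nat.ListAction using (sum)
open import Relation.Nullary using (¬_; does)
open import Relation.Binary.PropositionalEquality using (_≡_)

record Graph (n : ℕ) : Set where
  field
    adj   : Fin n → Fin n → Bool
    sym   : ∀ u v → adj u v ≡ adj v u
    irrefl : ∀ v → adj v v ≡ false

open Graph public

Coloring : ℕ → Set
Coloring n = Fin n → Bool

_==_ : Bool → Bool → Bool
true  == b = b
false == b = not b

nbrCount : ∀ {n} → Graph n → Coloring n → Fin n → Bool → ℕ
nbrCount {n} G col v c =
  sum (map (λ u → if adj G v u ∧ (col u == c) then 1 else 0) (allFin n))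

Switchable : ∀ {n} → Graph n → Coloring n → Fin n → Set
Switchable G col v = nbrCount G col v (not (col v)) < nbrCount G col v (col v)

Stable : ∀ {n} → Graph n → Coloring n → Set
Stable G col = ∀ v → ¬ Switchable G col v

switch : ∀ {n} → Coloring n → Fin n → Coloring n
switch col v u = if does (u ≟ v) then not (col u) else col u

data StabRun {n : ℕ} (G : Graph n) : Coloring n → ℕ → Set where
  done : ∀ {col} → Stable G col → StabRun G col 0
  step : ∀ {col k} (v : Fin n) → Switchable G col v →
         StabRun G (switch col v) k → StabRun G col (suc k)

module Submission where

-- Idea. An m × m grid of cells is flipped as a whole Θ(m) times by a chain of
-- L = 2m + 1 layers of 5m line nodes; fixed nodes, held in place by a large
-- complete bipartite graph, shift the threshold of each line node. A layer has
-- three nodes for each row and two for each column, adjacent to the cells on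
-- their line, and consecutive layers are completely joined. Colours s t
-- alternate along the layers. A node of layer t switches only once all of
-- layer t − 1 has; a column node must also wait until all cells of its column
-- have colour s t, and these are driven to that colour by the row nodes of
-- layer t. So a run cannot be stable before the last layer is reached, and
-- every layer costs m² cell switches: Θ(m³) steps on Θ(m²) nodes, whatever the
-- order. Runs to a stable colouring exist because every switch lowers the
-- number of monochromatic edges.

open import Defs renaming (sym to adj-sym)
open import Data.Nat
open import Data.Nat.Properties
open import Data.Nat.Induction using (<-wellFounded)
open import Data.Nat.Tactic.RingSolver using (solve-∀)
import Data.Nat.ListAction as List
open import Data.Bool using (Bool; true; false; not; _∧_; _∨_; _xor_; if_then_else_; T)
import Data.Bool.Properties as Bool
open import Data.Empty using (⊥-elim)
open import Data.Fin using (Fin; zero; suc; toℕ; punchIn; _↑ˡ_; _↑ʳ_; combine; fromℕ<; inject₁)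
import Data.Fin as Fin
open import Data.Fin.Patterns
import Data.Fin.Properties as Fin
open import Data.List using (tabulate)
open import Data.List.Properties using (map-tabulate)
open import Data.Product using (∃; ∃₂; _×_; _,_; proj₁; proj₂)
open import Data.Product.Function.NonDependent.Propositional using (_×-↔_)
open import Data.Sum using (_⊎_; inj₁; inj₂)
open import Data.Sum.Function.Propositional using (_⊎-↔_)
open import Data.Unit using (tt)
open import Function using (_∘_; id)
open import Function.Bundles using (_↔_; Inverse)
open import Function.Construct.Composition using (_↔-∘_)
open import Function.Construct.Identity using (↔-id)
open import Induction.WellFounded using (Acc; acc)
open import Relation.Binary using (tri<; tri≈; tri>)
open import Relation.Binary.PropositionalEquality
open import Relation.Nullary using (¬_; yes; no; does; contradiction)
open import Relation.Nullary.Decidable using (dec-true; dec-false)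
open import Algebra.Properties.Semiring.Sum +-*-semiring
  using (sum; sum-syntax; sum-cong-≗; sum-remove; ∑-distrib-+; sum-replicate-zero; ∑-comm)

-- Neighbour counts as finite sums, and the effect of a single switch.

𝟙 : Bool → ℕ
𝟙 b = if b then 1 else 0

sum-tabulate : ∀ {n} (f : Fin n → ℕ) → List.sum (tabulate f) ≡ sum f
sum-tabulate {zero}  f = refl
sum-tabulate {suc n} f = cong (f zero +_) (sum-tabulate (f ∘ suc))

nbrCount-∑ : ∀ {n} (G : Graph n) col v c →
             nbrCount G col v c ≡ ∑[ u < n ] 𝟙 (adj G v u ∧ (col u == c))
nbrCount-∑ G col v c = trans
  (cong List.sum (map-tabulate id (λ u → 𝟙 (adj G v u ∧ (col u == c)))))
  (sum-tabulate (λ u → 𝟙 (adj G v u ∧ (col u == c))))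

switch-self : ∀ {n} (col : Coloring n) v → switch col v v ≡ not (col v)
switch-self col v rewrite dec-true (v Fin.≟ v) refl = refl

switch-other : ∀ {n} (col : Coloring n) {u v} → u ≢ v → switch col v u ≡ col u
switch-other col {u} {v} u≢v rewrite dec-false (u Fin.≟ v) u≢v = refl

-- Energy of a colouring and termination of the process.

==-comm : ∀ a b → (a == b) ≡ (b == a)
==-comm false false = refl
==-comm false true  = refl
==-comm true  false = refl
==-comm true  true  = refl

-- Row `v` and column `v` agree by symmetry and meet in a zero entry, so together they contribute
-- twice the row sum. This isolates the part of the energy that a switch of `v` can change.
∑∑-remove : ∀ {n} (e : Fin (suc n) → Fin (suc n) → ℕ) v →
            e v v ≡ 0 → (∀ u → e u v ≡ e v u) →
            ∑[ u < suc n ] sum (e u) ≡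
            2 * sum (e v) + ∑[ u < n ] ∑[ w < n ] e (punchIn v u) (punchIn v w)
∑∑-remove {n} e v ev≡0 e-sym = begin
  ∑[ u < suc n ] sum (e u)
    ≡⟨ sum-remove {i = v} (sum ∘ e) ⟩
  sum (e v) + ∑[ u < n ] sum (e (punchIn v u))
    ≡⟨ cong (sum (e v) +_) (sum-cong-≗ (λ u → trans (sum-remove {i = v} (e (punchIn v u)))
         (cong (_+ R u) (e-sym (punchIn v u))))) ⟩
  sum (e v) + ∑[ u < n ] (e v (punchIn v u) + R u)
    ≡⟨ cong (sum (e v) +_) (∑-distrib-+ (e v ∘ punchIn v) R) ⟩
  sum (e v) + (sum (e v ∘ punchIn v) + sum R)
    ≡⟨ cong (λ z → sum (e v) + (z + sum R)) (sym row) ⟩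
  sum (e v) + (sum (e v) + sum R)
    ≡⟨ lem (sum (e v)) (sum R) ⟩
  2 * sum (e v) + sum R ∎
  where
  open ≡-Reasoning
  R : Fin n → ℕ
  R u = ∑[ w < n ] e (punchIn v u) (punchIn v w)
  row : sum (e v) ≡ sum (e v ∘ punchIn v)
  row = trans (sum-remove {i = v} (e v)) (cong (_+ sum (e v ∘ punchIn v)) ev≡0)
  lem : ∀ a b → a + (a + b) ≡ 2 * a + b
  lem = solve-∀

module _ {n} (G : Graph n) where

  conflict : Coloring n → Fin n → Fin n → ℕ
  conflict col u w = 𝟙 (adj G u w ∧ (col w == col u))

  -- The sum runs over ordered pairs, so every monochromatic edge counts twice.
  energy : Coloring n → ℕ
  energy col = ∑[ u < n ] sum (conflict col u)

  conflict-irrefl : ∀ col v → conflict col v v ≡ 0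
  conflict-irrefl col v rewrite irrefl G v = refl

  conflict-sym : ∀ col v u → conflict col u v ≡ conflict col v u
  conflict-sym col v u =
    cong₂ (λ a b → 𝟙 (a ∧ b)) (adj-sym G u v) (==-comm (col v) (col u))

-- Only pairs involving `v` change. They contribute twice the number of neighbours sharing the
-- colour of `v`, and after the switch those are the neighbours of the rarer colour.
energy-decreasing : ∀ {n} (G : Graph n) col v → Switchable G col v →
                    energy G (switch col v) < energy G col
energy-decreasing {suc n} G col v sw = begin-strict
  energy G col′
    ≡⟨ ∑∑-remove (conflict G col′) v (conflict-irrefl G col′ v) (conflict-sym G col′ v) ⟩
  2 * sum (conflict G col′ v) + rest col′
    ≡⟨ cong₂ (λ a b → 2 * a + b) (trans (sum-cong-≗ row) (sym (nbrCount-∑ G col v (not (col v)))))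
         (sum-cong-≗ (λ u → sum-cong-≗ (λ w → cong₂ (λ a b → 𝟙 (adj G _ _ ∧ (a == b)))
           (switch-other col (Fin.punchInᵢ≢i v w)) (switch-other col (Fin.punchInᵢ≢i v u))))) ⟩
  2 * nbrCount G col v (not (col v)) + rest col
    <⟨ +-monoˡ-< (rest col) (*-monoʳ-< 2 sw) ⟩
  2 * nbrCount G col v (col v) + rest col
    ≡⟨ cong (λ z → 2 * z + rest col) (nbrCount-∑ G col v (col v)) ⟩
  2 * sum (conflict G col v) + rest col
    ≡⟨ sym (∑∑-remove (conflict G col) v (conflict-irrefl G col v) (conflict-sym G col v)) ⟩
  energy G col ∎
  where
  open ≤-Reasoning
  col′ = switch col v
  rest : Coloring (suc n) → ℕ
  rest c = ∑[ u < n ] ∑[ w < n ] conflict G c (punchIn v u) (punchIn v w)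
  row : ∀ w → conflict G col′ v w ≡ 𝟙 (adj G v w ∧ (col w == not (col v)))
  row w with w Fin.≟ v
  ... | yes refl rewrite irrefl G v = refl
  ... | no w≢v = cong (λ a → 𝟙 (adj G v w ∧ (col w == a))) (switch-self col v)

stabilises : ∀ {n} (G : Graph n) col → Acc _<_ (energy G col) → ∃ λ k → StabRun G col k
stabilises G col (acc rs)
  with Fin.any? (λ v → nbrCount G col v (not (col v)) <? nbrCount G col v (col v))
... | yes (v , sw) =
  let k , run = stabilises G (switch col v) (rs (energy-decreasing G col v sw))
  in suc k , step v sw run
... | no stable = 0 , done (λ v sw → stable (v , sw))

-- Finite sums, indicators and counting by colour.

∑-split : ∀ a {b} (f : Fin (a + b) → ℕ) →
          sum f ≡ ∑[ i < a ] f (i ↑ˡ b) + ∑[ j < b ] f (a ↑ʳ j)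
∑-split zero    f = refl
∑-split (suc a) f =
  trans (cong (f zero +_) (∑-split a (f ∘ suc))) (sym (+-assoc (f zero) _ _))

∑-combine : ∀ a {b} (f : Fin (a * b) → ℕ) →
            sum f ≡ ∑[ i < a ] ∑[ j < b ] f (combine i j)
∑-combine zero        f = refl
∑-combine (suc a) {b} f =
  trans (∑-split b f) (cong (∑[ j < b ] f (j ↑ˡ a * b) +_) (∑-combine a (f ∘ (b ↑ʳ_))))

∑-zero : ∀ n → ∑[ i < n ] 0 ≡ 0
∑-zero = sum-replicate-zero

∑-mono : ∀ {n} (f g : Fin n → ℕ) → (∀ i → f i ≤ g i) → sum f ≤ sum g
∑-mono {zero}  f g f≤g = z≤n
∑-mono {suc n} f g f≤g = +-mono-≤ (f≤g zero) (∑-mono (f ∘ suc) (g ∘ suc) (f≤g ∘ suc))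

∑-const : ∀ n k → ∑[ i < n ] k ≡ n * k
∑-const zero    k = refl
∑-const (suc n) k = cong (k +_) (∑-const n k)

∑-bound : ∀ {n} (f : Fin n → ℕ) k → (∀ i → f i ≤ k) → sum f ≤ n * k
∑-bound {n} f k f≤k = ≤-trans (∑-mono f (λ _ → k) f≤k) (≤-reflexive (∑-const n k))

term≤∑ : ∀ {n} (f : Fin n → ℕ) i → f i ≤ sum f
term≤∑ f zero    = m≤m+n _ _
term≤∑ f (suc i) = ≤-trans (term≤∑ (f ∘ suc) i) (m≤n+m _ (f zero))

∑-select : ∀ {n} (p : Fin n → Bool) j → ∑[ i < n ] 𝟙 (does (j Fin.≟ i) ∧ p i) ≡ 𝟙 (p j)
∑-select {suc n} p zero    = trans (cong (𝟙 (p zero) +_) (∑-zero n)) (+-identityʳ _)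
∑-select {suc n} p (suc j) = ∑-select (p ∘ suc) j

∑-selectℕ : ∀ {n} (f : Fin n → ℕ) j → ∑[ i < n ] (if toℕ i ≡ᵇ toℕ j then f i else 0) ≡ f j
∑-selectℕ {suc n} f zero    = trans (cong (f zero +_) (∑-zero n)) (+-identityʳ _)
∑-selectℕ {suc n} f (suc j) = ∑-selectℕ (f ∘ suc) j

-- This realises a prescribed number `b` of fixed neighbours: a line node is joined to the first `b`
-- fixed nodes of a colour.
∑-below : ∀ {n} b → b ≤ n → ∑[ i < n ] 𝟙 (toℕ i <ᵇ b) ≡ b
∑-below {n}     zero    _         = ∑-zero n
∑-below {suc n} (suc b) (s≤s b≤n) = cong suc (∑-below b b≤n)

-- Consecutive arguments pair up into one value of each colour, whichever colour comes first.
∑-alternating : ∀ (g : Bool → ℕ) (h : ℕ → Bool) → (∀ n → h (suc n) ≡ not (h n)) →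
                ∀ q → ∑[ k < q * 2 ] g (h (toℕ k)) ≡ q * (g true + g false)
∑-alternating g h alt zero    = refl
∑-alternating g h alt (suc q) = begin
  g (h 0) + (g (h 1) + rest)        ≡⟨ cong (λ b → g (h 0) + (g b + rest)) (alt 0) ⟩
  g (h 0) + (g (not (h 0)) + rest)  ≡⟨ pair (h 0) ⟩
  g true + g false + rest
    ≡⟨ cong (g true + g false +_) (∑-alternating g (λ n → h (2 + n)) (λ n → alt (2 + n)) q) ⟩
  g true + g false + q * (g true + g false) ∎
  where
  open ≡-Reasoning
  rest = ∑[ k < q * 2 ] g (h (suc (suc (toℕ k))))
  pair : ∀ b → g b + (g (not b) + rest) ≡ g true + g false + rest
  pair true  = sym (+-assoc (g true) _ _)
  pair false = trans (sym (+-assoc (g false) _ _)) (cong (_+ rest) (+-comm (g false) (g true)))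

𝟙≤1 : ∀ b → 𝟙 b ≤ 1
𝟙≤1 true  = ≤-refl
𝟙≤1 false = z≤n

==-refl : ∀ b → (b == b) ≡ true
==-refl true  = refl
==-refl false = refl

𝟙-complement : ∀ b c → 𝟙 (b == c) + 𝟙 (b == not c) ≡ 1
𝟙-complement true  true  = refl
𝟙-complement true  false = refl
𝟙-complement false true  = refl
𝟙-complement false false = refl

≡ᵇ-comm : ∀ a b → (a ≡ᵇ b) ≡ (b ≡ᵇ a)
≡ᵇ-comm zero    zero    = refl
≡ᵇ-comm zero    (suc b) = refl
≡ᵇ-comm (suc a) zero    = refl
≡ᵇ-comm (suc a) (suc b) = ≡ᵇ-comm a b

-- The two tests exclude each other. With `a` the index of the layer before a given one, they pick
-- out its two neighbouring layers.
if-∨ : ∀ a x y → (if (x ≡ᵇ a) ∨ (x ≡ᵇ suc (suc a)) then y else 0) ≡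
                 (if x ≡ᵇ a then y else 0) + (if x ≡ᵇ suc (suc a) then y else 0)
if-∨ zero    zero    y = sym (+-identityʳ y)
if-∨ zero    (suc x) y = refl
if-∨ (suc a) zero    y = refl
if-∨ (suc a) (suc x) y = if-∨ a x y

toℕ-punchIn : ∀ {n} (t : Fin (suc n)) k →
              (toℕ (punchIn t k) ≡ toℕ k × toℕ k < toℕ t) ⊎
              (toℕ (punchIn t k) ≡ suc (toℕ k) × toℕ t ≤ toℕ k)
toℕ-punchIn zero    k       = inj₂ (refl , z≤n)
toℕ-punchIn (suc t) zero    = inj₁ (refl , s≤s z≤n)
toℕ-punchIn (suc t) (suc k) with toℕ-punchIn t k
... | inj₁ (eq , lt) = inj₁ (cong suc eq , s≤s lt)
... | inj₂ (eq , le) = inj₂ (cong suc eq , s≤s le)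

s : ℕ → Bool
s zero    = true
s (suc n) = not (s n)

isRow : Fin 5 → Bool
isRow κ = toℕ κ <ᵇ 3

∑-selectˡ : ∀ {n} (p : Fin n → Bool) j → ∑[ i < n ] 𝟙 (does (i Fin.≟ j) ∧ p i) ≡ 𝟙 (p j)
∑-selectˡ {suc n} p zero    = trans (cong (𝟙 (p zero) +_) (∑-zero n)) (+-identityʳ _)
∑-selectˡ {suc n} p (suc j) = ∑-selectˡ (p ∘ suc) j

∑-complement : ∀ {n} (f : Fin n → Bool) c →
               ∑[ i < n ] 𝟙 (f i == c) + ∑[ i < n ] 𝟙 (f i == not c) ≡ n
∑-complement {n} f c = begin
  ∑[ i < n ] 𝟙 (f i == c) + ∑[ i < n ] 𝟙 (f i == not c)
    ≡⟨ sym (∑-distrib-+ (λ i → 𝟙 (f i == c)) (λ i → 𝟙 (f i == not c))) ⟩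
  ∑[ i < n ] (𝟙 (f i == c) + 𝟙 (f i == not c))
    ≡⟨ sum-cong-≗ (λ i → 𝟙-complement (f i) c) ⟩
  ∑[ i < n ] 1
    ≡⟨ ∑-const n 1 ⟩
  n * 1
    ≡⟨ *-identityʳ n ⟩
  n ∎
  where open ≡-Reasoning

∑-𝟙-guard : ∀ {n} b (f : Fin n → Bool) →
            ∑[ i < n ] 𝟙 (b ∧ f i) ≡ (if b then ∑[ i < n ] 𝟙 (f i) else 0)
∑-𝟙-guard     true  f = refl
∑-𝟙-guard {n} false f = ∑-zero n

∑-if : ∀ {n} b (f : Fin n → ℕ) →
       ∑[ i < n ] (if b then f i else 0) ≡ (if b then ∑[ i < n ] f i else 0)
∑-if     true  f = refl
∑-if {n} false f = ∑-zero n

∑-update : ∀ {n} (f g : Fin n → ℕ) i → (∀ j → j ≢ i → g j ≤ f j) → g i ≤ suc (f i) →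
           sum g ≤ suc (sum f)
∑-update f g zero    others at =
  +-mono-≤ at (∑-mono (g ∘ suc) (f ∘ suc) (λ j → others (suc j) (λ ())))
∑-update f g (suc i) others at = ≤-trans
  (+-mono-≤ (others zero (λ ()))
    (∑-update (f ∘ suc) (g ∘ suc) i (λ j j≢i → others (suc j) (j≢i ∘ Fin.suc-injective)) at))
  (≤-reflexive (+-suc (f zero) _))

==-not : ∀ b → (b == not b) ≡ false
==-not true  = refl
==-not false = refl

not-== : ∀ b → (not b == b) ≡ false
not-== true  = refl
not-== false = refl

𝟙≡0⇒ : ∀ b c → 𝟙 (b == c) ≡ 0 → b ≡ not c
𝟙≡0⇒ true  false _ = refl
𝟙≡0⇒ false true  _ = refl

either : ∀ b c → b ≡ c ⊎ b ≡ not c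
either true  true  = inj₁ refl
either true  false = inj₂ refl
either false true  = inj₂ refl
either false false = inj₁ refl

≢not : ∀ {b c} → b ≡ c → b ≢ not c
≢not {true}  refl ()
≢not {false} refl ()

𝟙-imp : ∀ {b c b′ c′} → (b ≡ c → b′ ≡ c′) → 𝟙 (b == c) ≤ 𝟙 (b′ == c′)
𝟙-imp {b} {c} {b′} {c′} imp with either b c
... | inj₁ b≡c  rewrite imp b≡c | ==-refl c′ = 𝟙≤1 _
... | inj₂ refl rewrite not-== c = z≤n

-- Threshold inequalities for line nodes.

double-cancel : ∀ z u v {l r} → l ≡ z + 2 * u → r ≡ z + suc (2 * v) → l < r → u ≤ v
double-cancel z u v refl refl l<r = *-cancelˡ-≤ 2 (s≤s⁻¹ (+-cancelˡ-< z _ _ l<r))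

-- In the following p , p′ count the cells on a line, a , a′ the nodes of the
-- previous layer and b , b′ those of the next layer, split by colour.

row-waits : ∀ p p′ a a′ → p′ + (a′ + (a + a′) + 0) < p + (a + 0 + suc (p + p′)) → a′ ≤ p
row-waits p p′ a a′ = double-cancel (p′ + a) a′ p (lhs p p′ a a′) (rhs p p′ a)
  where
  lhs : ∀ p p′ a a′ → p′ + (a′ + (a + a′) + 0) ≡ p′ + a + 2 * a′
  lhs = solve-∀
  rhs : ∀ p p′ a → p + (a + 0 + suc (p + p′)) ≡ p′ + a + suc (2 * p)
  rhs = solve-∀

-- The bias `m₀` is one less than the length `p + p′` of the line, so cancelling leaves
-- `2 * (p′ + a′) < 1`: a single opposing cell or previous-layer node blocks the switch.
column-waits : ∀ m₀ p p′ a a′ → p + p′ ≡ suc m₀ →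
               p′ + (a′ + (a + a′) + m₀) < p + (a + 0 + 0) → p′ + a′ ≤ 0
column-waits m₀ p p′ a a′ eq lt =
  double-cancel (a + p) (p′ + a′) 0 (trans (cong (λ z → p′ + (a′ + (a + a′) + z)) (sym eq)) (lhs p p′ a a′)) (rhs p a)
    (≤-<-trans (≤-reflexive (shift p′ (a′ + (a + a′)) m₀)) (s≤s lt))
  where
  shift : ∀ u v m₀ → u + (v + suc m₀) ≡ suc (u + (v + m₀))
  shift = solve-∀
  lhs : ∀ p p′ a a′ → p′ + (a′ + (a + a′) + (p + p′)) ≡ a + p + 2 * (p′ + a′)
  lhs = solve-∀
  rhs : ∀ p a → suc (p + (a + 0 + 0)) ≡ a + p + suc (2 * 0)
  rhs = solve-∀

-- The bias `suc (p + p′)` exceeds the whole line, and the previous layer, of size `b + b′`, makes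
-- up for the next one.
row-rests : ∀ p p′ b b′ → ¬ (p + (b + b′ + b + suc (p + p′)) < p′ + (0 + b′ + 0))
row-rests p p′ b b′ lt = <⇒≱ lt (≤-trans (m≤m+n _ (2 * p + 2 * b + 1)) (≤-reflexive (eq p p′ b b′)))
  where
  eq : ∀ p p′ b b′ → p′ + (0 + b′ + 0) + (2 * p + 2 * b + 1) ≡ p + (b + b′ + b + suc (p + p′))
  eq = solve-∀

-- In the application `b` counts the switched nodes of the next layer, and `p′` the cells that pull
-- a switched column node back.
column-rests : ∀ m₀ p p′ b b′ → p + p′ ≡ suc m₀ →
               p + (b + b′ + b + 0) < p′ + (0 + b′ + m₀) → b < p′
column-rests m₀ p p′ b b′ eq lt = *-cancelˡ-< 2 b p′ (+-cancelˡ-< (p + b′) _ _ (begin-strict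
  p + b′ + 2 * b               ≡⟨ lhs p b b′ ⟩
  p + (b + b′ + b + 0)         <⟨ lt ⟩
  p′ + (0 + b′ + m₀)           ≤⟨ n≤1+n _ ⟩
  suc (p′ + (0 + b′ + m₀))     ≡⟨ shift p′ b′ m₀ ⟩
  p′ + (b′ + suc m₀)           ≡⟨ cong (λ z → p′ + (b′ + z)) (sym eq) ⟩
  p′ + (b′ + (p + p′))         ≡⟨ rhs p p′ b′ ⟩
  p + b′ + 2 * p′              ∎))
  where
  open ≤-Reasoning
  lhs : ∀ p b b′ → p + b′ + 2 * b ≡ p + (b + b′ + b + 0)
  lhs = solve-∀
  shift : ∀ u v m₀ → suc (u + (0 + v + m₀)) ≡ u + (v + suc m₀)
  shift = solve-∀
  rhs : ∀ p p′ b′ → p′ + (b′ + (p + p′)) ≡ p + b′ + 2 * p′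
  rhs = solve-∀

-- The bias `suc (p + p′)` alone beats a whole row of opposing cells.
row-ready : ∀ p p′ a → p′ + (0 + a + 0) < p + (a + 0 + suc (p + p′))
row-ready p p′ a = ≤-trans (s≤s (m≤m+n _ (2 * p))) (≤-reflexive (eq p p′ a))
  where
  eq : ∀ p p′ a → suc (p′ + (0 + a + 0) + 2 * p) ≡ p + (a + 0 + suc (p + p′))
  eq = solve-∀

-- A complete column of `suc m₀` cells beats the opposing bias by exactly one.
column-ready : ∀ m₀ a → 0 + (0 + a + m₀) < suc m₀ + (a + 0 + 0)
column-ready m₀ a = ≤-reflexive (eq m₀ a)
  where
  eq : ∀ m₀ a → suc (0 + (0 + a + m₀)) ≡ suc m₀ + (a + 0 + 0)
  eq = solve-∀

-- The vote of five line nodes at a cell.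

tally : (Fin 5 → Bool) → Bool → ℕ
tally y c = ∑[ κ < 5 ] 𝟙 (y κ == c)

Unanimous : (Fin 5 → Bool) → Bool → Set
Unanimous y c = ∀ κ → isRow κ ≡ true → y κ ≡ c

-- Three row nodes outvote two column nodes, whatever the latter show.
vote-switch : ∀ y c → Unanimous y (not c) → tally y c < tally y (not c)
vote-switch y c rows rewrite rows 0F refl | rows 1F refl | rows 2F refl
  with c | y 3F | y 4F
... | true  | true  | true  = <ᵇ⇒< _ _ tt
... | true  | true  | false = <ᵇ⇒< _ _ tt
... | true  | false | true  = <ᵇ⇒< _ _ tt
... | true  | false | false = <ᵇ⇒< _ _ tt
... | false | true  | true  = <ᵇ⇒< _ _ tt
... | false | true  | false = <ᵇ⇒< _ _ tt
... | false | false | true  = <ᵇ⇒< _ _ tt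
... | false | false | false = <ᵇ⇒< _ _ tt

-- With both column nodes of colour `c`, a majority against `c` among five needs all three row
-- nodes. Together with `vote-switch` this fixes the choice of three row and two column nodes.
vote-unanimous : ∀ y c → y 3F ≡ c → y 4F ≡ c → tally y c < tally y (not c) → Unanimous y (not c)
vote-unanimous y c y₃ y₄ lt = λ where
    0F _ → proj₁ rows
    1F _ → proj₁ (proj₂ rows)
    2F _ → proj₂ (proj₂ rows)
  where
  five : Bool → Bool → Bool → Bool → Bool → Bool → ℕ
  five a b d e f c = 𝟙 (a == c) + (𝟙 (b == c) + (𝟙 (d == c) + (𝟙 (e == c) + (𝟙 (f == c) + 0))))
  go : ∀ c a b d → T (five a b d c c c <ᵇ five a b d c c (not c)) →
       a ≡ not c × b ≡ not c × d ≡ not c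
  go true  false false false _ = refl , refl , refl
  go false true  true  true  _ = refl , refl , refl
  go true  true  false false ()
  go true  false true  false ()
  go true  true  true  false ()
  go true  false false true  ()
  go true  true  false true  ()
  go true  false true  true  ()
  go true  true  true  true  ()
  go false false false false ()
  go false true  false false ()
  go false false true  false ()
  go false true  true  false ()
  go false false false true  ()
  go false true  false true  ()
  go false false true  true  ()
  rows : y 0F ≡ not c × y 1F ≡ not c × y 2F ≡ not c
  rows = go c (y 0F) (y 1F) (y 2F) (subst₂ (λ e f → T (five (y 0F) (y 1F) (y 2F) e f c <ᵇ five (y 0F) (y 1F) (y 2F) e f (not c))) y₃ y₄ (<⇒<ᵇ lt))

∑-none : ∀ {n} (f : Fin n → Bool) c → (∀ i → f i ≡ not c) → ∑[ i < n ] 𝟙 (f i == c) ≡ 0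
∑-none {n} f c all = trans
  (sum-cong-≗ (λ i → cong 𝟙 (trans (cong (_== c) (all i)) (not-== c)))) (∑-zero n)

∑-none⁻¹ : ∀ {n} (f : Fin n → Bool) c → ∑[ i < n ] 𝟙 (f i == c) ≡ 0 → ∀ i → f i ≡ not c
∑-none⁻¹ f c none i = 𝟙≡0⇒ (f i) c
  (n≤0⇒n≡0 (≤-trans (term≤∑ (λ i → 𝟙 (f i == c)) i) (≤-reflexive none)))

-- The graph and its initial colouring.

module Construction (m₀ : ℕ) where

  m Q L N₀ D N : ℕ
  -- `Q` is even, so that the `Q` alternating layers other than the active one balance at every
  -- cell. `D` exceeds the number `N₀` of cells and line nodes, so that `D` fixed neighbours of one
  -- colour outweigh all of these.
  m  = suc m₀
  Q  = m * 2
  L  = suc Q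
  N₀ = m * m + L * (5 * m)
  D  = suc N₀
  N  = m * m + (L * (5 * m) + 2 * D)

  Node : Set
  Node = (Fin m × Fin m) ⊎ ((Fin L × (Fin 5 × Fin m)) ⊎ (Bool × Fin D))

  pattern cell i j   = inj₁ (i , j)
  pattern line t κ k = inj₂ (inj₁ (t , κ , k))
  pattern fix c d    = inj₂ (inj₂ (c , d))

  Fin↔Node : Fin N ↔ Node
  Fin↔Node = (Fin.*↔× ⊎-↔ ((layers ⊎-↔ fixes) ↔-∘ Fin.+↔⊎)) ↔-∘ Fin.+↔⊎
    where
    layers : Fin (L * (5 * m)) ↔ (Fin L × (Fin 5 × Fin m))
    layers = (↔-id _ ×-↔ Fin.*↔×) ↔-∘ Fin.*↔×
    fixes : Fin (2 * D) ↔ (Bool × Fin D)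
    fixes = (Fin.2↔Bool ×-↔ ↔-id _) ↔-∘ Fin.*↔×

  open Inverse Fin↔Node using () renaming (to to dec; from to enc; strictlyInverseˡ to dec-enc; strictlyInverseʳ to enc-dec)

  -- The first and the last layer have a neighbouring layer on one side only. They are frozen by `D`
  -- fixed neighbours of the opposite colour.
  anchored : Fin L → Bool
  anchored zero    = true
  anchored (suc t) = suc (toℕ t) ≡ᵇ Q

  -- Layer 0 starts out switched, so that layer 1 is the first to be active.
  start : Fin L → Bool
  start zero    = false
  start (suc t) = s (suc (toℕ t))

  -- bias t κ c is the number of fixed neighbours of colour c. It makes a row node
  -- switch as soon as layer t − 1 has, even though its whole row opposes it, and
  -- a column node only if its whole column favours it too.
  bias : Fin L → Fin 5 → Bool → ℕ
  bias t κ c =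
    if anchored t then (if start t == c then 0 else D)
    else if isRow κ then (if s (toℕ t) == c then suc m else 0)
    else (if s (toℕ t) == c then 0 else m₀)

  -- The line (κ , k) of the grid is row k if isRow κ, and column k otherwise.
  index : Fin 5 → Fin m → Fin m → Fin m
  index κ i j = if isRow κ then i else j

  incident : Fin 5 → Fin m → Fin m → Fin m → Bool
  incident κ k i j = does (index κ i j Fin.≟ k)

  consecutive : Fin L → Fin L → Bool
  consecutive t t′ = (suc (toℕ t′) ≡ᵇ toℕ t) ∨ (toℕ t′ ≡ᵇ suc (toℕ t))

  Adj : Node → Node → Bool
  Adj (cell _ _)   (cell _ _)    = false
  Adj (cell i j)   (line t κ k)  = incident κ k i j
  Adj (cell _ _)   (fix _ _)     = false
  Adj (line t κ k) (cell i j)    = incident κ k i j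
  Adj (line t _ _) (line t′ _ _) = consecutive t t′
  Adj (line t κ _) (fix c d)     = toℕ d <ᵇ bias t κ c
  Adj (fix _ _)    (cell _ _)    = false
  Adj (fix c d)    (line t κ _)  = toℕ d <ᵇ bias t κ c
  Adj (fix c _)    (fix c′ _)    = c xor c′

  Adj-sym : ∀ a b → Adj a b ≡ Adj b a
  Adj-sym (cell _ _)   (cell _ _)    = refl
  Adj-sym (cell _ _)   (line _ _ _)  = refl
  Adj-sym (cell _ _)   (fix _ _)     = refl
  Adj-sym (line _ _ _) (cell _ _)    = refl
  Adj-sym (line t _ _) (line t′ _ _) = trans
    (Bool.∨-comm (suc (toℕ t′) ≡ᵇ toℕ t) _)
    (cong₂ _∨_ (≡ᵇ-comm (toℕ t′) _) (≡ᵇ-comm (suc (toℕ t′)) (toℕ t)))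
  Adj-sym (line _ _ _) (fix _ _)     = refl
  Adj-sym (fix _ _)    (cell _ _)    = refl
  Adj-sym (fix _ _)    (line _ _ _)  = refl
  Adj-sym (fix c _)    (fix c′ _)    = Bool.xor-comm c c′

  Adj-irrefl : ∀ a → Adj a a ≡ false
  Adj-irrefl (cell _ _)   = refl
  Adj-irrefl (line t _ _) = go (toℕ t)
    where
    go : ∀ a → (suc a ≡ᵇ a) ∨ (a ≡ᵇ suc a) ≡ false
    go zero    = refl
    go (suc a) = go a
  Adj-irrefl (fix c _)    = Bool.xor-same c

  graph : Graph N
  graph = record
    { adj    = λ u v → Adj (dec u) (dec v)
    ; sym    = λ u v → Adj-sym (dec u) (dec v)
    ; irrefl = λ v → Adj-irrefl (dec v)
    }

  initial : Node → Bool
  initial (cell _ _)   = true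
  initial (line t _ _) = start t
  initial (fix c _)    = c

  -- Neighbour counts by type of neighbour.

  cells lines fixes : (Node → Bool) → Node → Bool → ℕ
  cells x a c = ∑[ i < m ] ∑[ j < m ] 𝟙 (Adj a (cell i j) ∧ (x (cell i j) == c))
  lines x a c = ∑[ t < L ] ∑[ κ < 5 ] ∑[ k < m ] 𝟙 (Adj a (line t κ k) ∧ (x (line t κ k) == c))
  fixes x a c = ∑[ d < D ] 𝟙 (Adj a (fix false d) ∧ (x (fix false d) == c)) +
                ∑[ d < D ] 𝟙 (Adj a (fix true d) ∧ (x (fix true d) == c))

  count : (Node → Bool) → Node → Bool → ℕ
  count x a c = cells x a c + (lines x a c + fixes x a c)

  -- `enc` unfolds to the injections and `combine` used by the splitting lemmas, so the summands
  -- match by computation.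
  ∑-enc : (f : Fin N → ℕ) → sum f ≡
          ∑[ i < m ] ∑[ j < m ] f (enc (cell i j)) +
          (∑[ t < L ] ∑[ κ < 5 ] ∑[ k < m ] f (enc (line t κ k)) +
           (∑[ d < D ] f (enc (fix false d)) + ∑[ d < D ] f (enc (fix true d))))
  ∑-enc f = trans (∑-split (m * m) f) (cong₂ _+_
    (∑-combine m {m} (λ u → f (u ↑ˡ (L * (5 * m) + 2 * D))))
    (trans (∑-split (L * (5 * m)) (λ u → f (m * m ↑ʳ u))) (cong₂ _+_
      (trans (∑-combine L {5 * m} (λ u → f (m * m ↑ʳ (u ↑ˡ 2 * D))))
        (sum-cong-≗ (λ t → ∑-combine 5 {m} (λ u → f (m * m ↑ʳ (combine {L} t u ↑ˡ 2 * D))))))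
      (trans (∑-combine 2 {D} (λ u → f (m * m ↑ʳ (L * (5 * m) ↑ʳ u))))
        (cong (∑[ d < D ] f (enc (fix false d)) +_) (+-identityʳ (∑[ d < D ] f (enc (fix true d)))))))))

  nbrCount-count : ∀ col a c → nbrCount graph col (enc a) c ≡ count (col ∘ enc) a c
  nbrCount-count col a c = trans (nbrCount-∑ graph col (enc a) c)
    (trans (∑-enc (λ u → 𝟙 (adj graph (enc a) u ∧ (col u == c)))) (cong₂ _+_
      (sum-cong-≗ (λ i → sum-cong-≗ (λ j → adj-enc (cell i j))))
      (cong₂ _+_
        (sum-cong-≗ (λ t → sum-cong-≗ (λ κ → sum-cong-≗ (λ k → adj-enc (line t κ k)))))
        (cong₂ _+_ (sum-cong-≗ (λ d → adj-enc (fix false d))) (sum-cong-≗ (λ d → adj-enc (fix true d)))))))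
    where
    adj-enc : ∀ b → 𝟙 (Adj (dec (enc a)) (dec (enc b)) ∧ (col (enc b) == c)) ≡
                    𝟙 (Adj a b ∧ (col (enc b) == c))
    adj-enc b = cong₂ (λ a′ b′ → 𝟙 (Adj a′ b′ ∧ (col (enc b) == c))) (dec-enc a) (dec-enc b)

  module _ (x : Node → Bool) where

    cellOn : Fin 5 → Fin m → Fin m → Node
    cellOn κ k l = if isRow κ then cell k l else cell l k

    onLine : Fin 5 → Fin m → Bool → ℕ
    onLine κ k c = ∑[ l < m ] 𝟙 (x (cellOn κ k l) == c)

    layer : Fin L → Bool → ℕ
    layer t c = ∑[ κ < 5 ] ∑[ k < m ] 𝟙 (x (line t κ k) == c)

    around : Fin L → Fin m → Fin m → Bool → ℕ
    around t i j c = ∑[ κ < 5 ] 𝟙 (x (line t κ (index κ i j)) == c)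

    onLine-complement : ∀ κ k c → onLine κ k c + onLine κ k (not c) ≡ m
    onLine-complement κ k = ∑-complement (λ l → x (cellOn κ k l))

    layer-complement : ∀ t c → layer t c + layer t (not c) ≡ 5 * m
    layer-complement t c = begin
      layer t c + layer t (not c)
        ≡⟨ sym (∑-distrib-+ (part c) (part (not c))) ⟩
      ∑[ κ < 5 ] (part c κ + part (not c) κ)
        ≡⟨ sum-cong-≗ (λ κ → ∑-complement (λ k → x (line t κ k)) c) ⟩
      ∑[ κ < 5 ] m
        ≡⟨ ∑-const 5 m ⟩
      5 * m ∎
      where
      open ≡-Reasoning
      part : Bool → Fin 5 → ℕ
      part c κ = ∑[ k < m ] 𝟙 (x (line t κ k) == c)

    -- For each layer and each `κ`, exactly one line passes through the cell.
    count-cell : ∀ i j c → count x (cell i j) c ≡ ∑[ t < L ] around t i j c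
    count-cell i j c = begin
      cells x (cell i j) c + (lines x (cell i j) c + fixes x (cell i j) c)
        ≡⟨ cong₂ _+_ (trans (sum-cong-≗ {m} (λ _ → ∑-zero m)) (∑-zero m))
             (cong₂ _+_ (sum-cong-≗ (λ t → sum-cong-≗ (λ κ →
                ∑-select (λ k → x (line t κ k) == c) (index κ i j))))
               (cong₂ _+_ (∑-zero D) (∑-zero D))) ⟩
      ∑[ t < L ] around t i j c + 0
        ≡⟨ +-identityʳ _ ⟩
      ∑[ t < L ] around t i j c ∎
      where open ≡-Reasoning

    cells-line : ∀ t κ k c → cells x (line t κ k) c ≡ onLine κ k c
    cells-line t κ k c with isRow κ
    ... | true  = trans (∑-comm (λ i j → 𝟙 (does (i Fin.≟ k) ∧ (x (cell i j) == c))))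
      (sum-cong-≗ (λ j → ∑-selectˡ (λ i → x (cell i j) == c) k))
    ... | false = sum-cong-≗ (λ i → ∑-selectˡ (λ j → x (cell i j) == c) k)

    lines-line : ∀ {t⁻ t t⁺} κ k c → toℕ t ≡ suc (toℕ t⁻) → toℕ t⁺ ≡ suc (toℕ t) →
                 lines x (line t κ k) c ≡ layer t⁻ c + layer t⁺ c
    lines-line {t⁻} {t} {t⁺} κ k c before after = begin
      lines x (line t κ k) c
        ≡⟨ sum-cong-≗ guard ⟩
      ∑[ t′ < L ] (if consecutive t t′ then layer t′ c else 0)
        ≡⟨ sum-cong-≗ splitting ⟩
      ∑[ t′ < L ] (below t′ + above t′)
        ≡⟨ ∑-distrib-+ below above ⟩
      sum below + sum above
        ≡⟨ cong₂ _+_ (∑-selectℕ (λ t′ → layer t′ c) t⁻) (∑-selectℕ (λ t′ → layer t′ c) t⁺) ⟩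
      layer t⁻ c + layer t⁺ c ∎
      where
      open ≡-Reasoning
      below above : Fin L → ℕ
      below t′ = if toℕ t′ ≡ᵇ toℕ t⁻ then layer t′ c else 0
      above t′ = if toℕ t′ ≡ᵇ toℕ t⁺ then layer t′ c else 0
      guard : ∀ t′ → ∑[ κ′ < 5 ] ∑[ k′ < m ] 𝟙 (consecutive t t′ ∧ (x (line t′ κ′ k′) == c)) ≡
                     (if consecutive t t′ then layer t′ c else 0)
      guard t′ = trans
        (sum-cong-≗ (λ κ′ → ∑-𝟙-guard (consecutive t t′) (λ k′ → x (line t′ κ′ k′) == c)))
        (∑-if (consecutive t t′) (λ κ′ → ∑[ k′ < m ] 𝟙 (x (line t′ κ′ k′) == c)))
      splitting : ∀ t′ → (if consecutive t t′ then layer t′ c else 0) ≡ below t′ + above t′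
      splitting t′ rewrite after | before = if-∨ (toℕ t⁻) (toℕ t′) (layer t′ c)

    module _ (fixed : ∀ c d → x (fix c d) ≡ c) where

      fixes-fixed : ∀ a c → fixes x a c ≡ ∑[ d < D ] 𝟙 (Adj a (fix c d))
      fixes-fixed a c = trans (cong₂ _+_ (part false) (part true)) (select c)
        where
        total : Bool → ℕ
        total c′ = ∑[ d < D ] 𝟙 (Adj a (fix c′ d))
        part : ∀ c′ → ∑[ d < D ] 𝟙 (Adj a (fix c′ d) ∧ (x (fix c′ d) == c)) ≡
                      (if c′ == c then total c′ else 0)
        part c′ = trans
          (sum-cong-≗ (λ d → cong 𝟙 (trans
            (cong (λ b → Adj a (fix c′ d) ∧ (b == c)) (fixed c′ d)) (Bool.∧-comm _ (c′ == c)))))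
          (∑-𝟙-guard {D} (c′ == c) (λ d → Adj a (fix c′ d)))
        select : ∀ c → (if false == c then total false else 0) + (if true == c then total true else 0) ≡
                       total c
        select false = +-identityʳ _
        select true  = refl

      fixes-line : ∀ t κ k c → bias t κ c ≤ D → fixes x (line t κ k) c ≡ bias t κ c
      fixes-line t κ k c ≤D = trans (fixes-fixed (line t κ k) c) (∑-below {D} (bias t κ c) ≤D)

      count-line : ∀ {t⁻ t t⁺} κ k c → toℕ t ≡ suc (toℕ t⁻) → toℕ t⁺ ≡ suc (toℕ t) → bias t κ c ≤ D →
                   count x (line t κ k) c ≡
                   onLine κ k c + (layer t⁻ c + layer t⁺ c + bias t κ c)
      count-line {t = t} κ k c before after ≤D = cong₂ _+_ (cells-line t κ k c)
        (cong₂ _+_ (lines-line κ k c before after) (fixes-line t κ k c ≤D))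

  -- Switchability on `Node`, and nodes that never switch.

  Switches : (Node → Bool) → Node → Set
  Switches x a = count x a (not (x a)) < count x a (x a)

  switches-as : ∀ x a {c} → x a ≡ c → Switches x a → count x a (not c) < count x a c
  switches-as x a refl sw = sw

  as-switches : ∀ x a {c} → x a ≡ c → count x a (not c) < count x a c → Switches x a
  as-switches x a refl sw = sw

  nonfixed-bound : ∀ x a c → cells x a c + lines x a c ≤ N₀
  nonfixed-bound x a c = +-mono-≤
    (∑-bound {m} _ m (λ i → ∑𝟙-bound m (λ j → Adj a (cell i j) ∧ (x (cell i j) == c))))
    (∑-bound {L} _ (5 * m) (λ t → ∑-bound {5} _ m (λ κ →
      ∑𝟙-bound m (λ k → Adj a (line t κ k) ∧ (x (line t κ k) == c)))))
    where
    ∑𝟙-bound : ∀ n (f : Fin n → Bool) → ∑[ i < n ] 𝟙 (f i) ≤ n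
    ∑𝟙-bound n f = ≤-trans (∑-bound _ 1 (λ i → 𝟙≤1 (f i))) (≤-reflexive (*-identityʳ n))

  -- At most `N₀` neighbours can share the colour of such a node, against `D` fixed neighbours of
  -- the other colour.
  anchored-stays : ∀ x a c → x a ≡ c → fixes x a c ≡ 0 → fixes x a (not c) ≡ D → ¬ Switches x a
  anchored-stays x a c xa none all sw = <⇒≱ (switches-as x a xa sw) (begin
    cells x a c + (lines x a c + fixes x a c)
      ≡⟨ cong (λ z → cells x a c + (lines x a c + z)) none ⟩
    cells x a c + (lines x a c + 0)
      ≡⟨ cong (cells x a c +_) (+-identityʳ _) ⟩
    cells x a c + lines x a c
      ≤⟨ nonfixed-bound x a c ⟩
    N₀
      ≤⟨ n≤1+n N₀ ⟩
    D
      ≡⟨ sym all ⟩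
    fixes x a (not c)
      ≤⟨ m≤n+m _ (lines x a (not c)) ⟩
    lines x a (not c) + fixes x a (not c)
      ≤⟨ m≤n+m _ (cells x a (not c)) ⟩
    count x a (not c) ∎)
    where open ≤-Reasoning

  bias-anchored : ∀ t κ c → anchored t ≡ true → bias t κ c ≡ (if start t == c then 0 else D)
  bias-anchored t κ c anch rewrite anch = refl

  bias-row : ∀ t κ c → anchored t ≡ false → isRow κ ≡ true →
             bias t κ c ≡ (if s (toℕ t) == c then suc m else 0)
  bias-row t κ c free row rewrite free | row = refl

  bias-column : ∀ t κ c → anchored t ≡ false → isRow κ ≡ false →
                bias t κ c ≡ (if s (toℕ t) == c then 0 else m₀)
  bias-column t κ c free col rewrite free | col = refl

  m<D : suc m ≤ D
  m<D = s≤s (≤-trans (m≤m*n m m) (m≤m+n (m * m) _))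

  bias≤D : ∀ t κ c → bias t κ c ≤ D
  bias≤D t κ c with anchored t | isRow κ | start t == c | s (toℕ t) == c
  ... | true  | _     | true  | _     = z≤n
  ... | true  | _     | false | _     = ≤-refl
  ... | false | true  | _     | true  = m<D
  ... | false | true  | _     | false = z≤n
  ... | false | false | _     | true  = z≤n
  ... | false | false | _     | false = ≤-trans (≤-trans (n≤1+n m₀) (n≤1+n m)) m<D

  record Inner (t⁻ t t⁺ : Fin L) : Set where
    field
      free   : anchored t ≡ false
      before : toℕ t ≡ suc (toℕ t⁻)
      after  : toℕ t⁺ ≡ suc (toℕ t)

  inner : ∀ t → anchored t ≡ false → ∃₂ λ t⁻ t⁺ → Inner t⁻ t t⁺
  inner (suc t) free = inject₁ t , fromℕ< t+2<L , record
    { free   = free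
    ; before = cong suc (sym (Fin.toℕ-inject₁ t))
    ; after  = Fin.toℕ-fromℕ< t+2<L
    }
    where
    t+2<L : suc (suc (toℕ t)) < L
    t+2<L = s≤s (≤∧≢⇒< (Fin.toℕ<n t) (λ eq → subst T (trans (cong (_≡ᵇ Q) (sym eq)) free) (≡⇒≡ᵇ Q Q refl)))

  module _ (x : Node → Bool) (fixed : ∀ c d → x (fix c d) ≡ c) where

    fix-stays : ∀ c d → ¬ Switches x (fix c d)
    fix-stays c d = anchored-stays x (fix c d) c (fixed c d)
      (trans (fixes-fixed x fixed (fix c d) c)
        (trans (sum-cong-≗ {D} (λ _ → cong 𝟙 (Bool.xor-same c))) (∑-zero D)))
      (trans (fixes-fixed x fixed (fix c d) (not c))
        (trans (sum-cong-≗ {D} (λ _ → cong 𝟙 (xor-not c))) (trans (∑-const D 1) (*-identityʳ D))))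
      where
      xor-not : ∀ c → c xor not c ≡ true
      xor-not true  = refl
      xor-not false = refl

    outer-stays : ∀ t κ k → anchored t ≡ true → x (line t κ k) ≡ start t → ¬ Switches x (line t κ k)
    outer-stays t κ k anch xt = anchored-stays x (line t κ k) (start t) xt
      (trans (value (start t)) (cong (λ b → if b then 0 else D) (==-refl (start t))))
      (trans (value (not (start t))) (cong (λ b → if b then 0 else D) (==-not (start t))))
      where
      value : ∀ c → fixes x (line t κ k) c ≡ (if start t == c then 0 else D)
      value c = trans (fixes-line x fixed t κ k c (bias≤D t κ c)) (bias-anchored t κ c anch)

    -- Switching conditions for the line nodes of an inner layer.

    module _ {t⁻ t t⁺ : Fin L} (inn : Inner t⁻ t t⁺) where
      open Inner inn

      private
        σ = s (toℕ t)
        p p′ : Fin 5 → Fin m → ℕ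
        p  κ k = onLine x κ k σ
        p′ κ k = onLine x κ k (not σ)
        a  = layer x t⁻ σ
        a′ = layer x t⁻ (not σ)
        b  = layer x t⁺ σ
        b′ = layer x t⁺ (not σ)
        a+a′ : a + a′ ≡ 5 * m
        a+a′ = layer-complement x t⁻ σ
        b+b′ : b + b′ ≡ 5 * m
        b+b′ = layer-complement x t⁺ σ

      count-row : ∀ κ k → isRow κ ≡ true → ∀ c → count x (line t κ k) c ≡
                  onLine x κ k c + (layer x t⁻ c + layer x t⁺ c + (if σ == c then suc m else 0))
      count-row κ k row c = trans (count-line x fixed κ k c before after (bias≤D t κ c))
        (cong (λ z → onLine x κ k c + (layer x t⁻ c + layer x t⁺ c + z)) (bias-row t κ c free row))

      count-column : ∀ κ k → isRow κ ≡ false → ∀ c → count x (line t κ k) c ≡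
                     onLine x κ k c + (layer x t⁻ c + layer x t⁺ c + (if σ == c then 0 else m₀))
      count-column κ k col c = trans (count-line x fixed κ k c before after (bias≤D t κ c))
        (cong (λ z → onLine x κ k c + (layer x t⁻ c + layer x t⁺ c + z)) (bias-column t κ c free col))

      row-σ : ∀ κ k → isRow κ ≡ true → count x (line t κ k) σ ≡ p κ k + (a + b + suc (p κ k + p′ κ k))
      row-σ κ k row = trans (count-row κ k row σ)
        (cong (λ z → p κ k + (a + b + z))
          (trans (cong (λ z → if z then suc m else 0) (==-refl σ)) (cong suc (sym (onLine-complement x κ k σ)))))

      row-¬σ : ∀ κ k → isRow κ ≡ true → count x (line t κ k) (not σ) ≡ p′ κ k + (a′ + b′ + 0)
      row-¬σ κ k row = trans (count-row κ k row (not σ))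
        (cong (λ z → p′ κ k + (a′ + b′ + z)) (cong (λ z → if z then suc m else 0) (==-not σ)))

      column-σ : ∀ κ k → isRow κ ≡ false → count x (line t κ k) σ ≡ p κ k + (a + b + 0)
      column-σ κ k col = trans (count-column κ k col σ)
        (cong (λ z → p κ k + (a + b + z)) (cong (λ z → if z then 0 else m₀) (==-refl σ)))

      column-¬σ : ∀ κ k → isRow κ ≡ false → count x (line t κ k) (not σ) ≡ p′ κ k + (a′ + b′ + m₀)
      column-¬σ κ k col = trans (count-column κ k col (not σ))
        (cong (λ z → p′ κ k + (a′ + b′ + z)) (cong (λ z → if z then 0 else m₀) (==-not σ)))

      -- Layer `t⁺` starts with colour `not σ`, so `b` counts its switched nodes. When there are
      -- none, `b′` is the size of a layer, written as `a + a′` to fit the threshold inequalities.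
      module _ (b≡0 : b ≡ 0) where
        private
          b′≡ : b′ ≡ a + a′
          b′≡ = trans (trans (cong (_+ b′) (sym b≡0)) b+b′) (sym a+a′)

        unswitched-row : ∀ κ k → isRow κ ≡ true → x (line t κ k) ≡ σ → Switches x (line t κ k) →
                         a′ ≤ p κ k
        unswitched-row κ k row xt sw = row-waits (p κ k) (p′ κ k) a a′
          (subst₂ _<_
            (trans (row-¬σ κ k row) (cong (λ z → p′ κ k + (a′ + z + 0)) b′≡))
            (trans (row-σ κ k row) (cong (λ z → p κ k + (a + z + suc (p κ k + p′ κ k))) b≡0))
            (switches-as x (line t κ k) xt sw))

        unswitched-column : ∀ κ k → isRow κ ≡ false → x (line t κ k) ≡ σ → Switches x (line t κ k) →
                            p′ κ k ≡ 0 × a′ ≡ 0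
        unswitched-column κ k col xt sw = m+n≡0⇒m≡0 (p′ κ k) sum≡0 , m+n≡0⇒n≡0 (p′ κ k) sum≡0
          where
          sum≡0 = n≤0⇒n≡0 (column-waits m₀ (p κ k) (p′ κ k) a a′ (onLine-complement x κ k σ)
            (subst₂ _<_
              (trans (column-¬σ κ k col) (cong (λ z → p′ κ k + (a′ + z + m₀)) b′≡))
              (trans (column-σ κ k col) (cong (λ z → p κ k + (a + z + 0)) b≡0))
              (switches-as x (line t κ k) xt sw)))

        module _ (a′≡0 : a′ ≡ 0) where

          row-switches : ∀ κ k → isRow κ ≡ true → x (line t κ k) ≡ σ → Switches x (line t κ k)
          row-switches κ k row xt = as-switches x (line t κ k) xt (subst₂ _<_
            (sym (trans (row-¬σ κ k row) (cong₂ (λ y z → p′ κ k + (y + z + 0)) a′≡0 b′≡a)))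
            (sym (trans (row-σ κ k row) (cong (λ z → p κ k + (a + z + suc (p κ k + p′ κ k))) b≡0)))
            (row-ready (p κ k) (p′ κ k) a))
            where
            b′≡a = trans b′≡ (trans (cong (a +_) a′≡0) (+-identityʳ a))

          column-switches : ∀ κ k → isRow κ ≡ false → x (line t κ k) ≡ σ → p′ κ k ≡ 0 →
                            Switches x (line t κ k)
          column-switches κ k col xt p′≡0 = as-switches x (line t κ k) xt (subst₂ _<_
            (sym (trans (column-¬σ κ k col) (trans (cong (λ q → q + (a′ + b′ + m₀)) p′≡0) (cong₂ (λ y z → 0 + (y + z + m₀)) a′≡0 b′≡a))))
            (sym (trans (column-σ κ k col) (cong₂ (λ q z → q + (a + z + 0)) p≡m b≡0)))
            (column-ready m₀ a))
            where
            b′≡a = trans b′≡ (trans (cong (a +_) a′≡0) (+-identityʳ a))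
            p≡m : p κ k ≡ m
            p≡m = trans (sym (+-identityʳ _)) (trans (cong (p κ k +_) (sym p′≡0)) (onLine-complement x κ k σ))

      -- Layer `t⁻` shows `σ` once switched, so `a′` counts its unswitched nodes. When there are
      -- none, `a` is the size of a layer, written as `b + b′`.
      module _ (a′≡0 : a′ ≡ 0) where
        private
          a≡ : a ≡ b + b′
          a≡ = trans (sym (+-identityʳ a)) (trans (trans (cong (a +_) (sym a′≡0)) a+a′) (sym b+b′))

        switched-as : ∀ κ k → x (line t κ k) ≡ not σ → Switches x (line t κ k) →
                      count x (line t κ k) σ < count x (line t κ k) (not σ)
        switched-as κ k xt sw = subst (λ c → count x (line t κ k) c < count x (line t κ k) (not σ))
          (Bool.not-involutive σ) (switches-as x (line t κ k) xt sw)

        switched-row : ∀ κ k → isRow κ ≡ true → x (line t κ k) ≡ not σ → ¬ Switches x (line t κ k)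
        switched-row κ k row xt sw = row-rests (p κ k) (p′ κ k) b b′
          (subst₂ _<_
            (trans (row-σ κ k row) (cong (λ z → p κ k + (z + b + suc (p κ k + p′ κ k))) a≡))
            (trans (row-¬σ κ k row) (cong (λ z → p′ κ k + (z + b′ + 0)) a′≡0))
            (switched-as κ k xt sw))

        switched-column : ∀ κ k → isRow κ ≡ false → x (line t κ k) ≡ not σ → Switches x (line t κ k) →
                          b < p′ κ k
        switched-column κ k col xt sw = column-rests m₀ (p κ k) (p′ κ k) b b′ (onLine-complement x κ k σ)
          (subst₂ _<_
            (trans (column-σ κ k col) (cong (λ z → p κ k + (z + b + 0)) a≡))
            (trans (column-¬σ κ k col) (cong (λ z → p′ κ k + (z + b′ + m₀)) a′≡0))
            (switched-as κ k xt sw))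

  -- The invariant of a phase, and the behaviour of cells under it.

  cellOn-row : ∀ (x : Node → Bool) κ k l → isRow κ ≡ true → cellOn x κ k l ≡ cell k l
  cellOn-row x κ k l row rewrite row = refl

  cellOn-column : ∀ (x : Node → Bool) κ k l → isRow κ ≡ false → cellOn x κ k l ≡ cell l k
  cellOn-column x κ k l col rewrite col = refl

  layer-none : ∀ x t c → (∀ κ k → x (line t κ k) ≡ not c) → layer x t c ≡ 0
  layer-none x t c all =
    trans (sum-cong-≗ (λ κ → ∑-none (λ k → x (line t κ k)) c (all κ))) (∑-zero 5)

  layer-full : ∀ x t c → (∀ κ k → x (line t κ k) ≡ c) → layer x t c ≡ 5 * m
  layer-full x t c all = begin
    layer x t c                       ≡⟨ sym (+-identityʳ _) ⟩
    layer x t c + 0                   ≡⟨ cong (layer x t c +_) (sym (layer-none x t (not c)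
                                           (λ κ k → trans (all κ k) (sym (Bool.not-involutive c))))) ⟩
    layer x t c + layer x t (not c)   ≡⟨ layer-complement x t c ⟩
    5 * m                             ∎
    where open ≡-Reasoning

  layer-none⁻¹ : ∀ x t c → layer x t c ≡ 0 → ∀ κ k → x (line t κ k) ≡ not c
  layer-none⁻¹ x t c none κ = ∑-none⁻¹ (λ k → x (line t κ k)) c
    (n≤0⇒n≡0 (≤-trans (term≤∑ (λ κ → ∑[ k < m ] 𝟙 (x (line t κ k) == c)) κ) (≤-reflexive none)))

  onLine≤m : ∀ x κ k c → onLine x κ k c ≤ m
  onLine≤m x κ k c = ≤-trans (m≤m+n _ _) (≤-reflexive (onLine-complement x κ k c))

  m<5m : m < 5 * m
  m<5m = m<m+n m z<s

  -- In phase `t`, layer `t` is the active one and the cells pass from `not σ` to `σ`. The last two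
  -- fields record the order of events: the row nodes of a row, then its cells, and a column node
  -- only after its whole column.
  record Invariant (t : Fin L) (x : Node → Bool) : Set where
    σ : Bool
    σ = s (toℕ t)
    field
      fixed        : ∀ c d → x (fix c d) ≡ c
      switched     : ∀ t′ κ k → toℕ t′ < toℕ t → x (line t′ κ k) ≡ not (s (toℕ t′))
      unswitched   : ∀ t′ κ k → toℕ t < toℕ t′ → x (line t′ κ k) ≡ s (toℕ t′)
      rows-first   : ∀ i j → x (cell i j) ≡ σ → Unanimous (λ κ → x (line t κ i)) (not σ)
      columns-last : ∀ κ i j → isRow κ ≡ false → x (line t κ j) ≡ not σ → x (cell i j) ≡ σ

    columns-wait : ∀ κ i j → isRow κ ≡ false → x (cell i j) ≡ not σ → x (line t κ j) ≡ σ
    columns-wait κ i j col xc with either (x (line t κ j)) σ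
    ... | inj₁ xl = xl
    ... | inj₂ xl = contradiction xc (≢not (columns-last κ i j col xl))

    -- Two column nodes per column: a row node of layer t + 1 sees a pending
    -- cell as support for switching, and this must be outweighed.
    pending-columns : ∀ κ k → isRow κ ≡ true →
                      onLine x κ k (not σ) + onLine x κ k (not σ) ≤ layer x t σ
    pending-columns κ k row = begin
      onLine x κ k (not σ) + onLine x κ k (not σ)
        ≤⟨ +-mono-≤ (pending 3F refl) (≤-trans (pending 4F refl) (m≤m+n _ 0)) ⟩
      part 3F + (part 4F + 0)
        ≤⟨ m≤n+m _ (part 2F) ⟩
      part 2F + (part 3F + (part 4F + 0))
        ≤⟨ m≤n+m _ (part 1F) ⟩
      part 1F + (part 2F + (part 3F + (part 4F + 0)))
        ≤⟨ m≤n+m _ (part 0F) ⟩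
      layer x t σ ∎
      where
      open ≤-Reasoning
      part : Fin 5 → ℕ
      part κ′ = ∑[ l < m ] 𝟙 (x (line t κ′ l) == σ)
      pending : ∀ κ′ → isRow κ′ ≡ false → onLine x κ k (not σ) ≤ part κ′
      pending κ′ col = ∑-mono _ _ (λ l → 𝟙-imp (λ xc →
        columns-wait κ′ k l col (trans (cong x (sym (cellOn-row x κ k l row))) xc)))

    -- The cells of a column lie in distinct rows, and each finished one certifies switched row
    -- nodes in its row. Counting a single kind of row node suffices.
    finished-rows : ∀ κ k → isRow κ ≡ false → onLine x κ k σ ≤ layer x t (not σ)
    finished-rows κ k col = ≤-trans
      (∑-mono _ _ (λ l → 𝟙-imp (λ xc →
        rows-first l k (trans (cong x (sym (cellOn-column x κ k l col))) xc) 0F refl)))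
      (m≤m+n _ _)

    colour : ∀ k κ l → x (line (punchIn t k) κ l) ≡ s (suc (toℕ k))
    colour k κ l with toℕ-punchIn t k
    ... | inj₁ (eq , lt) = trans (switched (punchIn t k) κ l (subst (_< toℕ t) (sym eq) lt))
                                 (cong (not ∘ s) eq)
    ... | inj₂ (eq , le) = trans (unswitched (punchIn t k) κ l (subst (toℕ t <_) (sym eq) (s≤s le)))
                                 (cong s eq)

    voters : Fin m → Fin m → Fin 5 → Bool
    voters i j κ = x (line t κ (index κ i j))

    -- Layers before t have switched and those after t have not, so the layers
    -- other than t show the colours s 1 , … , s Q whatever t is: they cancel in
    -- the vote at a cell, and layer t decides it.
    count-voters : ∀ i j c → count x (cell i j) c ≡ tally (voters i j) c + m * 5
    count-voters i j c = begin
      count x (cell i j) c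
        ≡⟨ count-cell x i j c ⟩
      ∑[ t′ < L ] around x t′ i j c
        ≡⟨ sum-remove {i = t} (λ t′ → around x t′ i j c) ⟩
      tally (voters i j) c + ∑[ k < Q ] around x (punchIn t k) i j c
        ≡⟨ cong (tally (voters i j) c +_) (sum-cong-≗ {Q} (λ k → sum-cong-≗ {5} (λ κ →
             cong (λ b → 𝟙 (b == c)) (colour k κ (index κ i j))))) ⟩
      tally (voters i j) c + ∑[ k < Q ] tally (λ _ → s (suc (toℕ k))) c
        ≡⟨ cong (tally (voters i j) c +_)
             (∑-alternating (λ b → tally (λ _ → b) c) (s ∘ suc) (λ _ → refl) m) ⟩
      tally (voters i j) c + m * (tally (λ _ → true) c + tally (λ _ → false) c)
        ≡⟨ cong (λ z → tally (voters i j) c + m * z) (five c) ⟩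
      tally (voters i j) c + m * 5 ∎
      where
      open ≡-Reasoning
      five : ∀ c → tally (λ _ → true) c + tally (λ _ → false) c ≡ 5
      five true  = refl
      five false = refl

    row-voter : ∀ i j κ → isRow κ ≡ true → voters i j κ ≡ x (line t κ i)
    row-voter i j κ row = cong (λ b → x (line t κ (if b then i else j))) row

    -- Both column nodes through an unfinished cell still show `σ`, so the vote can only be won by
    -- all three row nodes.
    unfinished-cell : ∀ i j → x (cell i j) ≡ not σ → Switches x (cell i j) →
                      Unanimous (λ κ → x (line t κ i)) (not σ)
    unfinished-cell i j xc sw κ row = trans (sym (row-voter i j κ row))
      (vote-unanimous (voters i j) σ (columns-wait 3F i j refl xc) (columns-wait 4F i j refl xc)
        (+-cancelʳ-< (m * 5) _ _ (subst₂ _<_ (count-voters i j σ) (count-voters i j (not σ))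
          (subst (λ c → count x (cell i j) c < count x (cell i j) (not σ)) (Bool.not-involutive σ)
            (switches-as x (cell i j) xc sw)))) κ row)

    vote-against : ∀ i j → Unanimous (λ κ → x (line t κ i)) (not σ) →
                   count x (cell i j) σ < count x (cell i j) (not σ)
    vote-against i j rows = subst₂ _<_ (sym (count-voters i j σ)) (sym (count-voters i j (not σ)))
      (+-monoˡ-< (m * 5) (vote-switch (voters i j) σ (λ κ row → trans (row-voter i j κ row) (rows κ row))))

    -- The row nodes that made the cell switch have kept `not σ` in the majority, so it does not
    -- switch back.
    finished-cell : ∀ i j → x (cell i j) ≡ σ → ¬ Switches x (cell i j)
    finished-cell i j xc sw =
      <-asym (switches-as x (cell i j) xc sw) (vote-against i j (rows-first i j xc))

    ready-cell : ∀ i j → x (cell i j) ≡ not σ → Unanimous (λ κ → x (line t κ i)) (not σ) →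
                 Switches x (cell i j)
    ready-cell i j xc rows = as-switches x (cell i j) xc
      (subst (λ c → count x (cell i j) c < count x (cell i j) (not σ)) (sym (Bool.not-involutive σ))
        (vote-against i j rows))

  -- Which line nodes can switch during a phase.

  module _ {t : Fin L} {x : Node → Bool} (inv : Invariant t x) where
    open Invariant inv

    module _ {t⁻ t′ t⁺ : Fin L} (inn : Inner t⁻ t′ t⁺) where
      open Inner inn

      previous-switched : toℕ t⁻ < toℕ t → layer x t⁻ (not (s (toℕ t′))) ≡ 0
      previous-switched lt = layer-none x t⁻ _ (λ κ k → trans (switched t⁻ κ k lt)
        (trans (cong s (sym before)) (sym (Bool.not-involutive _))))

      next-unswitched : toℕ t < toℕ t⁺ → layer x t⁺ (s (toℕ t′)) ≡ 0
      next-unswitched lt = layer-none x t⁺ _ (λ κ k → trans (unswitched t⁺ κ k lt) (cong s after))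

      previous-unswitched : toℕ t < toℕ t⁻ → layer x t⁻ (not (s (toℕ t′))) ≡ 5 * m
      previous-unswitched lt = layer-full x t⁻ _ (λ κ k → trans (unswitched t⁻ κ k lt)
        (trans (sym (Bool.not-involutive _)) (cong (not ∘ s) (sym before))))

      next-switched : toℕ t⁺ < toℕ t → layer x t⁺ (s (toℕ t′)) ≡ 5 * m
      next-switched lt = layer-full x t⁺ _ (λ κ k → trans (switched t⁺ κ k lt)
        (trans (cong (not ∘ s) after) (Bool.not-involutive _)))

    -- Row nodes are held by their bias. A column node would need more cells of its colour than
    -- there are switched nodes in layer `t⁺`. Either that layer has switched entirely, or it is
    -- active and `finished-rows` applies.
    earlier-stays : ∀ {t⁻ t′ t⁺} → Inner t⁻ t′ t⁺ → ∀ κ k → toℕ t′ < toℕ t → ¬ Switches x (line t′ κ k)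
    earlier-stays {t⁻} {t′} {t⁺} inn κ k lt sw with either (isRow κ) true
    ... | inj₁ row = switched-row x fixed inn
            (previous-switched inn (<-trans (≤-reflexive (sym (Inner.before inn))) lt)) κ k row (switched t′ κ k lt) sw
    ... | inj₂ col = <⇒≱ (switched-column x fixed inn
            (previous-switched inn (<-trans (≤-reflexive (sym (Inner.before inn))) lt)) κ k col (switched t′ κ k lt) sw)
            (bound (m≤n⇒m<n∨m≡n (subst (_≤ toℕ t) (sym (Inner.after inn)) lt)))
      where
      bound : toℕ t⁺ < toℕ t ⊎ toℕ t⁺ ≡ toℕ t →
              onLine x κ k (not (s (toℕ t′))) ≤ layer x t⁺ (s (toℕ t′))
      bound (inj₁ lt) = ≤-trans (≤-trans (onLine≤m x κ k _) (<⇒≤ m<5m)) (≤-reflexive (sym (next-switched inn lt)))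
      bound (inj₂ eq) with refl ← Fin.toℕ-injective eq =
        subst₂ (λ c c′ → onLine x κ k c ≤ layer x t c′) (cong s (Inner.after inn))
          (trans (cong (not ∘ s) (Inner.after inn)) (Bool.not-involutive _)) (finished-rows κ k col)

    -- Beyond the layer next to `t`, a node faces `5 * m` unswitched nodes, more than the at most
    -- `m` cells of its line can offset. In the layer next to `t`, a column node tolerates no
    -- unswitched node before it, and a row node only as many as its row has pending cells.
    later-stays : layer x t σ ≢ 0 → ∀ {t⁻ t′ t⁺} → Inner t⁻ t′ t⁺ → ∀ κ k → toℕ t < toℕ t′ →
                  ¬ Switches x (line t′ κ k)
    later-stays nz {t⁻} {t′} {t⁺} inn κ k lt sw
      with either (isRow κ) true | m≤n⇒m<n∨m≡n (s≤s⁻¹ (subst (toℕ t <_) (Inner.before inn) lt))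
    ... | inj₁ row | inj₁ lt⁻ = <⇒≱ m<5m (≤-trans (≤-reflexive (sym (previous-unswitched inn lt⁻)))
            (≤-trans (unswitched-row x fixed inn none κ k row (unswitched t′ κ k lt) sw) (onLine≤m x κ k _)))
      where none = next-unswitched inn (<-trans lt (≤-reflexive (sym (Inner.after inn))))
    ... | inj₂ col | inj₁ lt⁻ = 1+n≢0 (trans (sym (previous-unswitched inn lt⁻))
            (proj₂ (unswitched-column x fixed inn none κ k col (unswitched t′ κ k lt) sw)))
      where none = next-unswitched inn (<-trans lt (≤-reflexive (sym (Inner.after inn))))
    ... | inj₂ col | inj₂ eq with refl ← Fin.toℕ-injective eq = nz (trans
            (cong (layer x t) (trans (sym (Bool.not-involutive _)) (cong (not ∘ s) (sym (Inner.before inn)))))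
            (proj₂ (unswitched-column x fixed inn none κ k col (unswitched t′ κ k lt) sw)))
      where none = next-unswitched inn (<-trans lt (≤-reflexive (sym (Inner.after inn))))
    -- With `u` unswitched nodes in layer `t` and `q` pending cells in the row, `u ≤ q` and
    -- `2 * q ≤ u` force `u` to be zero.
    ... | inj₁ row | inj₂ eq with refl ← Fin.toℕ-injective eq = nz (n≤0⇒n≡0 (+-cancelˡ-≤ (layer x t σ) _ _
            (≤-trans (+-mono-≤ few few) (≤-trans (pending-columns κ k row) (≤-reflexive (sym (+-identityʳ _)))))))
      where
      none = next-unswitched inn (<-trans lt (≤-reflexive (sym (Inner.after inn))))
      few : layer x t σ ≤ onLine x κ k (not σ)
      few = subst₂ (λ c c′ → layer x t c ≤ onLine x κ k c′)
        (trans (cong (not ∘ s) (Inner.before inn)) (Bool.not-involutive _)) (cong s (Inner.before inn))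
        (unswitched-row x fixed inn none κ k row (unswitched t′ κ k lt) sw)

    current-switches : ∀ {t⁻ t⁺} → Inner t⁻ t t⁺ → ∀ κ k → Switches x (line t κ k) →
                       x (line t κ k) ≡ σ × (isRow κ ≡ false → ∀ i → x (cell i k) ≡ σ)
    current-switches {t⁻} {t⁺} inn κ k sw with either (x (line t κ k)) σ | either (isRow κ) true
    ... | inj₂ xt | inj₁ row = ⊥-elim (switched-row x fixed inn
            (previous-switched inn (≤-reflexive (sym (Inner.before inn)))) κ k row xt sw)
    ... | inj₂ xt | inj₂ col = contradiction
            (switched-column x fixed inn (previous-switched inn (≤-reflexive (sym (Inner.before inn)))) κ k col xt sw)
            (≤⇒≯ (≤-trans (≤-reflexive (∑-none (λ l → x (cellOn x κ k l)) (not σ) (λ l →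
              trans (cong x (cellOn-column x κ k l col)) (trans (columns-last κ l k col xt) (sym (Bool.not-involutive σ)))))) z≤n))
    ... | inj₁ xt | inj₁ row = xt , λ col → contradiction (trans (sym row) col) (λ ())
    ... | inj₁ xt | inj₂ col = xt , λ _ i → trans (cong x (sym (cellOn-column x κ k i col)))
            (trans (∑-none⁻¹ (λ l → x (cellOn x κ k l)) (not σ) (proj₁
              (unswitched-column x fixed inn (next-unswitched inn (≤-reflexive (sym (Inner.after inn)))) κ k col xt sw)) i)
              (Bool.not-involutive σ))

  -- A single step preserves the invariant and finishes at most one cell.

  Flip : Node → (Node → Bool) → (Node → Bool) → Set
  Flip a x x′ = (x′ a ≡ not (x a)) × (∀ b → b ≢ a → x′ b ≡ x b)

  finished : Fin L → (Node → Bool) → ℕ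
  finished t x = ∑[ i < m ] ∑[ j < m ] 𝟙 (x (cell i j) == s (toℕ t))

  module _ {t : Fin L} {x : Node → Bool} (inv : Invariant t x) where
    open Invariant inv

    -- Layer `0` starts as a switched layer and layer `Q` as an unswitched one. For `t` strictly
    -- between them, the invariant asks for just these states.
    anchored-colour : ∀ t′ κ k → 0 < toℕ t → toℕ t < Q → anchored t′ ≡ true → x (line t′ κ k) ≡ start t′
    anchored-colour zero     κ k 0<t t<Q anch = switched zero κ k 0<t
    anchored-colour (suc t′) κ k 0<t t<Q anch = unswitched (suc t′) κ k
      (subst (toℕ t <_) (sym (≡ᵇ⇒≡ (suc (toℕ t′)) Q (subst T (sym anch) tt))) t<Q)

    line-switches : 0 < toℕ t → toℕ t < Q → layer x t σ ≢ 0 → ∀ t′ κ k → Switches x (line t′ κ k) →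
                    t′ ≡ t × x (line t κ k) ≡ σ × (isRow κ ≡ false → ∀ i → x (cell i k) ≡ σ)
    line-switches 0<t t<Q nz t′ κ k sw with either (anchored t′) true
    ... | inj₁ anch = contradiction sw
            (outer-stays x fixed t′ κ k anch (anchored-colour t′ κ k 0<t t<Q anch))
    ... | inj₂ free with inner t′ free | <-cmp (toℕ t′) (toℕ t)
    ... | _ , _ , inn | tri< lt _ _ = contradiction sw (earlier-stays inv inn κ k lt)
    ... | _ , _ , inn | tri> _ _ gt = contradiction sw (later-stays inv nz inn κ k gt)
    ... | _ , _ , inn | tri≈ _ eq _ with refl ← Fin.toℕ-injective eq = refl , current-switches inv inn κ k sw

    preserve-line : ∀ {x′} κ k → Flip (line t κ k) x x′ → x (line t κ k) ≡ σ →
                    (isRow κ ≡ false → ∀ i → x (cell i k) ≡ σ) → Invariant t x′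
    preserve-line {x′} κ k (at , off) xt column = record
      { fixed        = λ c d → trans (off (fix c d) (λ ())) (fixed c d)
      ; switched     = λ t′ κ′ k′ lt → trans
          (off (line t′ κ′ k′) (λ { refl → <-irrefl refl lt })) (switched t′ κ′ k′ lt)
      ; unswitched   = λ t′ κ′ k′ lt → trans
          (off (line t′ κ′ k′) (λ { refl → <-irrefl refl lt })) (unswitched t′ κ′ k′ lt)
      ; rows-first   = λ i j xc κ′ row →
          let old = rows-first i j (trans (sym (off (cell i j) (λ ()))) xc) κ′ row
          -- The flipped node showed `σ`, hence is none of the row nodes already at `not σ`.
          in trans (off (line t κ′ i) (λ eq → ≢not (trans (cong x eq) xt) old)) old
      ; columns-last = λ κ′ i j col xl → trans (off (cell i j) (λ ())) (columns-last′ κ′ i j col xl)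
      }
      where
      columns-last′ : ∀ κ′ i j → isRow κ′ ≡ false → x′ (line t κ′ j) ≡ not σ → x (cell i j) ≡ σ
      columns-last′ κ′ i j col xl with κ′ Fin.≟ κ | j Fin.≟ k
      ... | yes refl | yes refl = column col i
      ... | yes refl | no j≢k   = columns-last κ′ i j col
              (trans (sym (off (line t κ′ j) (λ { refl → j≢k refl }))) xl)
      ... | no κ′≢κ  | _        = columns-last κ′ i j col
              (trans (sym (off (line t κ′ j) (λ { refl → κ′≢κ refl }))) xl)

    finished-line : ∀ {x′} κ k → Flip (line t κ k) x x′ → finished t x′ ≡ finished t x
    finished-line κ k (at , off) = sum-cong-≗ {m} (λ i → sum-cong-≗ {m} (λ j →
      cong (λ b → 𝟙 (b == σ)) (off (cell i j) (λ ()))))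

    preserve-cell : ∀ {x′} i j → Flip (cell i j) x x′ → x (cell i j) ≡ not σ →
                    Unanimous (λ κ → x (line t κ i)) (not σ) → Invariant t x′
    preserve-cell {x′} i j (at , off) xc rows = record
      { fixed        = λ c d → trans (off (fix c d) (λ ())) (fixed c d)
      ; switched     = λ t′ κ k lt → trans (off (line t′ κ k) (λ ())) (switched t′ κ k lt)
      ; unswitched   = λ t′ κ k lt → trans (off (line t′ κ k) (λ ())) (unswitched t′ κ k lt)
      ; rows-first   = λ i′ j′ xc′ κ row → trans (off (line t κ i′) (λ ())) (rows-first′ i′ j′ xc′ κ row)
      ; columns-last = λ κ i′ j′ col xl →
          let old = columns-last κ i′ j′ col (trans (sym (off (line t κ j′) (λ ()))) xl)
          in trans (off (cell i′ j′) (λ eq → ≢not old (trans (cong x eq) xc))) old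
      }
      where
      rows-first′ : ∀ i′ j′ → x′ (cell i′ j′) ≡ σ → Unanimous (λ κ → x (line t κ i′)) (not σ)
      rows-first′ i′ j′ xc′ with i′ Fin.≟ i
      ... | yes refl = rows
      ... | no i′≢i  = rows-first i′ j′ (trans (sym (off (cell i′ j′) (λ { refl → i′≢i refl }))) xc′)

    finished-step : ∀ {x′} i j → Flip (cell i j) x x′ → finished t x′ ≤ suc (finished t x)
    finished-step {x′} i j (at , off) = ∑-update (row x) (row x′) i
      (λ i′ i′≢i → ∑-mono _ _ (λ j′ → same i′ j′ (λ { refl → i′≢i refl })))
      (∑-update (λ j → 𝟙 (x (cell i j) == σ)) (λ j → 𝟙 (x′ (cell i j) == σ)) j
        (λ j′ j′≢j → same i j′ (λ { refl → j′≢j refl })) (≤-trans (𝟙≤1 _) (s≤s z≤n)))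
      where
      row : (Node → Bool) → Fin m → ℕ
      row x i = ∑[ j < m ] 𝟙 (x (cell i j) == σ)
      same : ∀ i′ j′ → cell i′ j′ ≢ cell i j → 𝟙 (x′ (cell i′ j′) == σ) ≤ 𝟙 (x (cell i′ j′) == σ)
      same i′ j′ ne = ≤-reflexive (cong (λ b → 𝟙 (b == σ)) (off (cell i′ j′) ne))

    -- Fixed nodes never switch, line nodes leave the cells unchanged, and a cell adds at most
    -- itself to the finished ones.
    node-step : 0 < toℕ t → toℕ t < Q → layer x t σ ≢ 0 → ∀ a {x′} → Flip a x x′ → Switches x a →
                Invariant t x′ × finished t x′ ≤ suc (finished t x)
    node-step 0<t t<Q nz (fix c d) _ sw = contradiction sw (fix-stays x fixed c d)
    node-step 0<t t<Q nz (cell i j) flip sw with either (x (cell i j)) σ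
    ... | inj₁ xc = contradiction sw (finished-cell i j xc)
    ... | inj₂ xc = preserve-cell i j flip xc (unfinished-cell i j xc sw) , finished-step i j flip
    node-step 0<t t<Q nz (line t′ κ k) flip sw with line-switches 0<t t<Q nz t′ κ k sw
    ... | refl , xt , column =
      preserve-line κ k flip xt column ,
      ≤-trans (≤-reflexive (finished-line κ k flip)) (n≤1+n _)

    -- Completion of a phase and passage to the next.

    stable-layer : ∀ {t⁻ t⁺} → Inner t⁻ t t⁺ → (∀ a → ¬ Switches x a) → layer x t σ ≡ 0
    stable-layer {t⁻} {t⁺} inn stable = layer-none x t σ all
      where
      prev≡0 = previous-switched inv inn (≤-reflexive (sym (Inner.before inn)))
      next≡0 = next-unswitched inv inn (≤-reflexive (sym (Inner.after inn)))
      -- Stability is used in the order of a phase: an unswitched row node could switch; with all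
      -- rows switched, an unfinished cell could; with all cells finished, an unswitched column node
      -- could.
      rows : ∀ κ k → isRow κ ≡ true → x (line t κ k) ≡ not σ
      rows κ k row with either (x (line t κ k)) σ
      ... | inj₂ xt = xt
      ... | inj₁ xt = contradiction (row-switches x fixed inn next≡0 prev≡0 κ k row xt) (stable (line t κ k))
      cells-finished : ∀ i j → x (cell i j) ≡ σ
      cells-finished i j with either (x (cell i j)) σ
      ... | inj₁ xc = xc
      ... | inj₂ xc = contradiction (ready-cell i j xc (λ κ → rows κ i)) (stable (cell i j))
      columns : ∀ κ k → isRow κ ≡ false → x (line t κ k) ≡ not σ
      columns κ k col with either (x (line t κ k)) σ
      ... | inj₂ xt = xt
      ... | inj₁ xt = contradiction
              (column-switches x fixed inn next≡0 prev≡0 κ k col xt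
                (∑-none (λ l → x (cellOn x κ k l)) (not σ) (λ l →
                  trans (cong x (cellOn-column x κ k l col))
                    (trans (cells-finished l k) (sym (Bool.not-involutive σ))))))
              (stable (line t κ k))
      all : ∀ κ k → x (line t κ k) ≡ not σ
      all κ k with either (isRow κ) true
      ... | inj₁ row = rows κ k row
      ... | inj₂ col = columns κ k col

    module _ (exhausted : layer x t σ ≡ 0) where

      all-switched : ∀ κ k → x (line t κ k) ≡ not σ
      all-switched = layer-none⁻¹ x t σ exhausted

      cells-finished : ∀ i j → x (cell i j) ≡ σ
      cells-finished i j = columns-last 3F i j refl (all-switched 3F j)

      -- All cells show the colour that is unfinished for phase `t⁺`, and layer `t⁺` is untouched,
      -- so both ordering conditions hold vacuously.
      advance : ∀ t⁺ → toℕ t⁺ ≡ suc (toℕ t) → Invariant t⁺ x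
      advance t⁺ eq = record
        { fixed        = fixed
        ; switched     = λ t′ κ k lt → switched′ t′ κ k (m≤n⇒m<n∨m≡n (s≤s⁻¹ (subst (toℕ t′ <_) eq lt)))
        ; unswitched   = λ t′ κ k lt → unswitched t′ κ k (<-trans (≤-reflexive (sym eq)) lt)
        ; rows-first   = λ i j xc → contradiction (trans xc (cong s eq)) (≢not (cells-finished i j))
        ; columns-last = λ κ i j col xl →
            contradiction xl (≢not (unswitched t⁺ κ j (≤-reflexive (sym eq))))
        }
        where
        switched′ : ∀ t′ κ k → toℕ t′ < toℕ t ⊎ toℕ t′ ≡ toℕ t → x (line t′ κ k) ≡ not (s (toℕ t′))
        switched′ t′ κ k (inj₁ lt) = switched t′ κ k lt
        switched′ t′ κ k (inj₂ eq) with refl ← Fin.toℕ-injective eq = all-switched κ k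

      finished-next : ∀ t⁺ → toℕ t⁺ ≡ suc (toℕ t) → finished t⁺ x ≡ 0
      finished-next t⁺ eq = trans
        (sum-cong-≗ {m} (λ i → ∑-none (λ j → x (cell i j)) (s (toℕ t⁺)) (λ j →
          trans (cells-finished i j) (trans (sym (Bool.not-involutive σ)) (cong (not ∘ s) (sym eq))))))
        (∑-zero m)

      finished-all : finished t x ≡ m * m
      finished-all = trans
        (sum-cong-≗ {m} (λ i → trans
          (sum-cong-≗ {m} (λ j → cong 𝟙 (trans (cong (_== σ) (cells-finished i j)) (==-refl σ))))
          (trans (∑-const m 1) (*-identityʳ m))))
        (∑-const m m)

  -- Transfer to colourings of `Fin N` and the lower bound on runs.

  inner-of : ∀ t → 0 < toℕ t → toℕ t < Q → ∃₂ λ t⁻ t⁺ → Inner t⁻ t t⁺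
  inner-of (suc t) _ t<Q = inner (suc t) (free (either (anchored (suc t)) true))
    where
    free : anchored (suc t) ≡ true ⊎ anchored (suc t) ≡ false → anchored (suc t) ≡ false
    free (inj₁ anch) = contradiction (≡ᵇ⇒≡ (suc (toℕ t)) Q (subst T (sym anch) tt)) (<⇒≢ t<Q)
    free (inj₂ free) = free

  switchable⇒ : ∀ col v → Switchable graph col v → Switches (col ∘ enc) (dec v)
  switchable⇒ col v sw = subst₂ _<_ (nbrCount-count col (dec v) _) (nbrCount-count col (dec v) _)
    (subst (Switchable graph col) (sym (enc-dec v)) sw)

  switches⇒ : ∀ col a → Switches (col ∘ enc) a → Switchable graph col (enc a)
  switches⇒ col a = subst₂ _<_ (sym (nbrCount-count col a _)) (sym (nbrCount-count col a _))

  enc-injective : ∀ {a b} → enc a ≡ enc b → a ≡ b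
  enc-injective {a} {b} eq = trans (sym (dec-enc a)) (trans (cong dec eq) (dec-enc b))

  switch-flips : ∀ col v → Flip (dec v) (col ∘ enc) (switch col v ∘ enc)
  switch-flips col v = subst (λ w → Flip (dec v) (col ∘ enc) (switch col w ∘ enc)) (enc-dec v)
    (switch-self col (enc (dec v)) , λ b b≢a → switch-other col (b≢a ∘ enc-injective))

  -- Each of the `r` phases left before layer `Q` needs `m * m` cell switches, and `finished`
  -- credits those already made in the current one. The induction is on `r` and on the run: a phase
  -- change takes no step and trades a full credit for an empty one.
  lower-bound : ∀ {k col} r t → toℕ t + r ≡ Q → 0 < toℕ t → Invariant t (col ∘ enc) →
                StabRun graph col k → r * (m * m) ≤ k + finished t (col ∘ enc)
  lower-bound zero t eq 0<t inv run = z≤n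
  lower-bound {k} {col} (suc r) t eq 0<t inv run with layer (col ∘ enc) t (s (toℕ t)) ≟ 0
  ... | yes exhausted = begin
    m * m + r * (m * m)
      ≤⟨ +-monoʳ-≤ (m * m) (lower-bound r t⁺ (trans (cong (_+ r) t⁺≡) (trans (sym (+-suc (toℕ t) r)) eq))
           (≤-trans z<s (≤-reflexive (sym t⁺≡))) (advance inv exhausted t⁺ t⁺≡) run) ⟩
    m * m + (k + finished t⁺ (col ∘ enc))
      ≡⟨ cong₂ (λ y z → y + (k + z)) (sym (finished-all inv exhausted)) (finished-next inv exhausted t⁺ t⁺≡) ⟩
    finished t (col ∘ enc) + (k + 0)
      ≡⟨ cong (finished t (col ∘ enc) +_) (+-identityʳ k) ⟩
    finished t (col ∘ enc) + k
      ≡⟨ +-comm _ k ⟩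
    k + finished t (col ∘ enc) ∎
    where
    open ≤-Reasoning
    t<Q : toℕ t < Q
    t<Q = subst (toℕ t <_) eq (m<m+n (toℕ t) z<s)
    t⁺ = fromℕ< (s≤s t<Q)
    t⁺≡ : toℕ t⁺ ≡ suc (toℕ t)
    t⁺≡ = Fin.toℕ-fromℕ< (s≤s t<Q)
  lower-bound {col = col} (suc r) t eq 0<t inv (done stable) | no nz =
    let _ , _ , inn = inner-of t 0<t (subst (toℕ t <_) eq (m<m+n (toℕ t) z<s))
    in contradiction (stable-layer inv inn (λ a sw → stable (enc a) (switches⇒ col a sw))) nz
  lower-bound {suc k} {col} (suc r) t eq 0<t inv (step v sw run) | no nz =
    let inv′ , progress = node-step inv 0<t (subst (toℕ t <_) eq (m<m+n (toℕ t) z<s)) nz (dec v)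
                            (switch-flips col v) (switchable⇒ col v sw)
    in ≤-trans (lower-bound (suc r) t eq 0<t inv′ run)
         (≤-trans (+-monoʳ-≤ k progress) (≤-reflexive (+-suc k _)))

  col₀ : Coloring N
  col₀ = initial ∘ dec

  initial-invariant : Invariant 1F (col₀ ∘ enc)
  initial-invariant = record
    { fixed        = λ c d → at (fix c d)
    ; switched     = λ { zero κ k _ → at (line zero κ k) ; (suc t) κ k (s≤s ()) }
    ; unswitched   = λ { (suc t) κ k _ → at (line (suc t) κ k) }
    ; rows-first   = λ i j xc → contradiction (trans (sym (at (cell i j))) xc) (λ ())
    ; columns-last = λ κ i j _ xl → contradiction (trans (sym (at (line 1F κ j))) xl) (λ ())
    }
    where
    at : ∀ a → col₀ (enc a) ≡ initial a
    at a = cong initial (dec-enc a)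

  initial-finished : finished 1F (col₀ ∘ enc) ≡ 0
  initial-finished = trans
    (sum-cong-≗ {m} (λ i → ∑-none (λ j → col₀ (enc (cell i j))) false (λ j → cong initial (dec-enc (cell i j)))))
    (∑-zero m)

  cubic-bound : ∀ {k} → StabRun graph col₀ k → m * (m * m) ≤ k
  cubic-bound {k} run = begin
    m * (m * m)
      -- Layers `1` to `Q - 1` give `2 * m - 1` phases, of which `m` are kept.
      ≤⟨ *-monoˡ-≤ (m * m) (s≤s (m≤m*n m₀ 2)) ⟩
    suc (m₀ * 2) * (m * m)
      ≤⟨ lower-bound (suc (m₀ * 2)) 1F refl z<s initial-invariant run ⟩
    k + finished 1F (col₀ ∘ enc)
      ≡⟨ cong (k +_) initial-finished ⟩
    k + 0
      ≡⟨ +-identityʳ k ⟩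
    k ∎
    where open ≤-Reasoning

  -- Number of nodes and the exponent `3/2`.

  size : N ≤ 50 * (m * m)
  -- `N` equals `33 * m ^ 2 + 15 * m + 2`, and `50 = 33 + 15 + 2` makes the bound tight at `m = 1`.
  -- The added term is the slack, expanded in `m₀`.
  size = ≤-trans (m≤m+n N (17 * (m₀ * m₀) + 19 * m₀)) (≤-reflexive (eq m₀))
    where
    eq : ∀ m₀ → suc m₀ * suc m₀ + (suc (suc m₀ * 2) * (5 * suc m₀) +
                2 * suc (suc m₀ * suc m₀ + suc (suc m₀ * 2) * (5 * suc m₀))) +
                (17 * (m₀ * m₀) + 19 * m₀) ≡ 50 * (suc m₀ * suc m₀)
    eq = solve-∀

  m₀≤N : m₀ ≤ N
  m₀≤N = ≤-trans (n≤1+n m₀) (≤-trans (m≤m*n m m) (m≤m+n (m * m) _))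

  -- The constant 400 is large enough because `50 ^ 3 = 125000` is at most `400 ^ 2 = 160000`. The
  -- rest is that `m ^ 6` is both the cube of `m * m` and the square of `m * (m * m)`.
  ratio : ∀ {k} → m * (m * m) ≤ k → 1 ^ 2 * N ^ 3 ≤ 400 ^ 2 * k ^ 2
  ratio {k} m³≤k = begin
    1 ^ 2 * N ^ 3
      ≡⟨ *-identityˡ (N ^ 3) ⟩
    N ^ 3
      ≤⟨ ^-monoˡ-≤ 3 size ⟩
    (50 * (m * m)) ^ 3
      ≡⟨ cube-* 50 (m * m) ⟩
    50 ^ 3 * (m * m) ^ 3
      ≤⟨ *-monoˡ-≤ ((m * m) ^ 3) (≤ᵇ⇒≤ (50 ^ 3) (400 ^ 2) tt) ⟩
    400 ^ 2 * (m * m) ^ 3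
      ≡⟨ cong (400 ^ 2 *_) (eq m) ⟩
    400 ^ 2 * (m * (m * m)) ^ 2
      ≤⟨ *-monoʳ-≤ (400 ^ 2) (^-monoˡ-≤ 2 m³≤k) ⟩
    400 ^ 2 * k ^ 2 ∎
    where
    open ≤-Reasoning
    cube-* : ∀ c w → c * w * (c * w * (c * w * 1)) ≡ c * (c * (c * 1)) * (w * (w * (w * 1)))
    cube-* = solve-∀
    eq : ∀ m → m * m * (m * m * (m * m * 1)) ≡ m * (m * m) * (m * (m * m) * 1)
    eq = solve-∀

-- Squaring clears the exponent `3/2`, with `c = p / q`. The grid parameter `m₀` is the prescribed
-- lower bound on the number of nodes, which yields infinitely many sizes.
theorem2 : ∃ λ (p : ℕ) → ∃ λ (q : ℕ) → 0 < p × 0 < q ×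
               (∀ (N : ℕ) → ∃ λ (n : ℕ) → n ≥ N × ∃ λ (G : Graph n) → ∃ λ (col₀ : Coloring n) →
                 (∃ λ (k : ℕ) → StabRun G col₀ k) ×
                 (∀ (k : ℕ) → StabRun G col₀ k → (p ^ 2) * (n ^ 3) ≤ (q ^ 2) * (k ^ 2)))
theorem2 = 1 , 400 , z<s , z<s , λ m₀ →
  let open Construction m₀ in
  N , m₀≤N , graph , col₀ ,
  stabilises graph col₀ (<-wellFounded _) ,
  λ k run → ratio (cubic-bound run)
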